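{- $\displaystyle\lim_{n\to\infty} \frac{p_{\mathbb P}(n)}{M_{\{1\}\cup\mathbb P}(n)} = 0$, and consequently $\displaystyle\lim_{n\to\infty}\frac{p_{\mathbb P}(n)}{M(n)} = 0$.
   Context: $\mathbb P$ is the set of primes. $p_{\mathbb P}(n)$ is the number of partitions of $n$ into prime parts. For a set $T$ of positive integers, $M_T(n)$ is the number of distinct values of the multinomial coefficients $n!/(\lambda_1!\cdots\lambda_r!)$ as $(\lambda_1,\dots,\lambda_r)$ ranges over the partitions of $n$ with all parts in $T$; $M(n)$ is $M_T(n)$ for $T$ the set of all positive integers. -}

module Defs where

open import Level using (0ℓ)
open import Data.Nat using (ℕ; zero; suc; _∸_; _!; _*_; _/_; NonZero; _⊓_)
open import Data.Nat.Properties using (_≟_; m*n≢0; _!≢0)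
open import Data.Nat.Primality using (Prime; prime?)
open import Data.List using (List; []; _∷_; [_]; map; concatMap; applyUpTo; filter; length; deduplicate)
open import Data.List.Relation.Unary.All using (All; all?)
open import Data.Sum using (_⊎_)
open import Relation.Unary using (Pred; Decidable)
open import Relation.Binary.PropositionalEquality using (_≡_)
open import Relation.Nullary.Decidable using (_⊎-dec_)

-- ptsF fuel n m : all partitions of n (as non-increasing lists of
-- positive parts) whose largest part is ≤ m.  Fuel ≥ n suffices.
ptsF : ℕ → ℕ → ℕ → List (List ℕ)
ptsF _ zero _ = [ [] ]
ptsF zero (suc n) _ = []
ptsF (suc f) (suc n) m =
  concatMap (λ k → map (k ∷_) (ptsF f (suc n ∸ k) k)) (applyUpTo suc (m ⊓ suc n))

partitions : ℕ → List (List ℕ)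
partitions n = ptsF n n n

partitionsIn : {T : Pred ℕ 0ℓ} → Decidable T → ℕ → List (List ℕ)
partitionsIn T? n = filter (all? T?) (partitions n)

prodFact : List ℕ → ℕ
prodFact [] = 1
prodFact (k ∷ ks) = k ! * prodFact ks

prodFact≢0 : ∀ ks → NonZero (prodFact ks)
prodFact≢0 [] = _
prodFact≢0 (k ∷ ks) = m*n≢0 (k !) (prodFact ks) {{k !≢0}} {{prodFact≢0 ks}}

multinomial : ℕ → List ℕ → ℕ
multinomial n ks = (n ! / prodFact ks) {{prodFact≢0 ks}}

M-in : {T : Pred ℕ 0ℓ} → Decidable T → ℕ → ℕ
M-in T? n = length (deduplicate _≟_ (map (multinomial n) (partitionsIn T? n)))

OneOrPrime : Pred ℕ 0ℓ
OneOrPrime k = k ≡ 1 ⊎ Prime k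

oneOrPrime? : Decidable OneOrPrime
oneOrPrime? k = (k ≟ 1) ⊎-dec prime? k

pPrime : ℕ → ℕ
pPrime n = length (partitionsIn prime? n)

M : ℕ → ℕ
M n = length (deduplicate _≟_ (map (multinomial n) (partitions n)))

-- f(n)/g(n) → 0 as n → ∞, for ℕ-valued f, g:
-- for every ε = 1/(k+1) there is N with f(n)/g(n) < ε for all n ≥ N,
-- i.e. (k+1)·f(n) < g(n)  (which also forces g(n) > 0).
RatioTendsToZero : (ℕ → ℕ) → (ℕ → ℕ) → Set
RatioTendsToZero f g = ∀ (k : ℕ) → Σ ℕ λ N → ∀ n → N ≤ n → suc k * f n < g n
  where open import Data.Product using (Σ)
        open import Data.Nat using (_≤_; _<_)

{-# OPTIONS --safe #-}

-- By Euclid's lemma the largest part of a partition into ones and primes can be read off from the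
-- product of the factorials of its parts, so distinct such partitions of n have distinct multinomial
-- coefficients; it remains to see that partitions of n into primes are rare among them.  Fix K and
-- put T = K 2^K.  A prime partition with at least T parts has K distinct parts or a part of
-- multiplicity at least 2^K.  Replacing 2^i copies of a part p by ones therefore yields K partitions,
-- and the number 2^i p of ones reveals p and i.  A prime partition of n with fewer than T parts has,
-- for large n, a part p ≥ 2TK.  Replacing it by T i twos and p - 2 T i ones, for i < K, again
-- yields K partitions: fewer than T twos were there before, so the number of twos reveals i.

module Submission where

open import Defs
open import Data.List using (List; []; _∷_; [_]; _++_; map; applyUpTo; filter; length; deduplicate; replicate; upTo)
open import Data.List.Properties using (length-++; length-map; length-upTo; filter-++; filter-accept; filter-none; filter-reject; length-filter; ∷-injective)
open import Data.List.Membership.Propositional using (_∈_; find)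
open import Data.List.Membership.Propositional.Properties using (∈-++⁺ˡ; ∈-++⁺ʳ; ∈-++⁻; ∈-∃++; ∈-map⁺; ∈-map⁻; ∈-concatMap⁺; ∈-concatMap⁻; ∈-applyUpTo⁺; ∈-applyUpTo⁻; ∈-upTo⁻; ∈-filter⁺; ∈-filter⁻; ∈-deduplicate⁺)
open import Data.List.Relation.Binary.Permutation.Propositional using (_↭_; refl; prep; swap; trans; ↭-refl; ↭-sym; ↭-trans)
open import Data.List.Relation.Binary.Permutation.Propositional.Properties using (All-resp-↭; ↭-length; shift; drop-∷; filter-↭; ++⁺ˡ)
open import Data.List.Relation.Unary.All as All using (All; []; _∷_; all?)
import Data.List.Relation.Unary.All.Properties as All
import Data.List.Relation.Unary.AllPairs.Properties as AllPairs
open import Data.List.Relation.Unary.Any as Any using (here; there)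
open import Data.List.Relation.Unary.Linked as Linked using (Linked; []; [-]; _∷_)
open import Data.List.Relation.Unary.Linked.Properties using (Linked⇒All)
open import Data.List.Relation.Unary.Unique.Propositional using (Unique; []; _∷_)
import Data.List.Relation.Unary.Unique.Propositional.Properties as Unique
open import Data.Nat using (ℕ; zero; suc; _+_; _*_; _∸_; _^_; _!; _⊓_; _≤_; _<_; _≥_; z≤n; s≤s; s≤s⁻¹; NonZero; >-nonZero; >-nonZero⁻¹; nonTrivial⇒n>1)
open import Data.Nat.Combinatorics using (k![n∸k]!∣n!)
open import Data.Nat.Divisibility
open import Data.Nat.DivMod using (m/n*n≡m)
open import Data.Nat.ListAction using (sum)
open import Data.Nat.ListAction.Properties using (sum-++; sum-↭)
open import Data.Nat.Primality using (Prime; prime?; euclidsLemma; prime⇒nonTrivial; prime⇒irreducible; prime[2])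
open import Data.Nat.Properties
open import Data.Product using (∃; _×_; _,_; proj₁; proj₂)
open import Data.Sum using (_⊎_; inj₁; inj₂)
open import Function using (_∘_; id; it)
open import Level using (0ℓ)
open import Relation.Binary.Construct.Flip.EqAndOrd using () renaming (decTotalOrder to flipDecTotalOrder)
open import Relation.Binary.PropositionalEquality using (_≡_; _≢_; refl; sym; cong; cong₂; subst; module ≡-Reasoning) renaming (trans to ≡-trans)
open import Relation.Nullary using (¬_; yes; no; contradiction; ¬?)
open import Relation.Unary using (Pred; Decidable)
open import Data.List.Sort (flipDecTotalOrder ≤-decTotalOrder) using (sort; sort-↭; sort-↗)

-- Pigeonhole principles

module _ {A B : Set} {R : A → B → Set} (injective : ∀ {x x′ y} → R x y → R x′ y → x ≡ x′) where

  -- Induction on `xs`: the witness of the head is deleted from `ys`. By injectivity no later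
  -- element is related to it, so the later witnesses survive.
  pigeonhole : ∀ {xs ys} → Unique xs → All (λ x → ∃ λ y → y ∈ ys × R x y) xs → length xs ≤ length ys
  pigeonhole [] [] = z≤n
  pigeonhole {x ∷ xs} (x∉xs ∷ xs!) ((y , y∈ys , r) ∷ rs)
    with as , bs , refl ← ∈-∃++ y∈ys = begin
      suc (length xs)           ≤⟨ s≤s (pigeonhole xs! (All.zipWith avoid (x∉xs , rs))) ⟩
      suc (length (as ++ bs))   ≡⟨ ↭-length (shift y as bs) ⟨
      length (as ++ y ∷ bs)     ∎
    where
    open ≤-Reasoning
    avoid : ∀ {x′} → x ≢ x′ × (∃ λ z → z ∈ as ++ y ∷ bs × R x′ z) → ∃ λ z → z ∈ as ++ bs × R x′ z
    avoid (x≢x′ , z , z∈ , r′) with ∈-++⁻ as z∈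
    ... | inj₁ z∈as         = z , ∈-++⁺ˡ z∈as , r′
    ... | inj₂ (here refl)  = contradiction (injective r r′) x≢x′
    ... | inj₂ (there z∈bs) = z , ∈-++⁺ʳ as z∈bs , r′

module _ {A C B : Set} (R : A × C → B → Set) (K : ℕ) (ys : List B) where

  Image : A × C → Set
  Image x = ∃ λ y → y ∈ ys × R x y

  -- The labels `cs` may depend on `a`: below they are prime-exponent pairs in one case and plain
  -- indices in the other.
  Images : A → Set
  Images a = ∃ λ (cs : List C) → Unique cs × length cs ≡ K × All (λ c → Image (a , c)) cs

  private
    pairs : ∀ {as} → Unique as → All Images as →
            ∃ λ ps → Unique ps × length ps ≡ length as * K × All Image ps × All ((_∈ as) ∘ proj₁) ps
    pairs [] [] = [] , [] , refl , [] , []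
    pairs {a ∷ as} as!@(_ ∷ as!′) ((cs , cs! , |cs| , im) ∷ ims)
      with ps , ps! , |ps| , imₚ , ∈ₚ ← pairs as!′ ims =
        map (a ,_) cs ++ ps
      , Unique.++⁺ (Unique.map⁺ (cong proj₂) cs!) ps! disjoint
      , ≡-trans (length-++ (map (a ,_) cs)) (cong₂ _+_ (≡-trans (length-map (a ,_) cs) |cs|) |ps|)
      , All.++⁺ (All.map⁺ im) imₚ
      , All.++⁺ (All.map⁺ (All.universal (λ _ → here refl) cs)) (All.map there ∈ₚ)
      where
      disjoint : ∀ {p} → ¬ (p ∈ map (a ,_) cs × p ∈ ps)
      disjoint (p∈ , p∈ps) with _ , _ , refl ← ∈-map⁻ (a ,_) p∈ =
        Unique.Unique[x∷xs]⇒x∉xs as! (All.lookup ∈ₚ p∈ps)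

  -- Injectivity on pairs `(a , c)` also separates the images of different `a`, so `pigeonhole`
  -- applies to the list of all pairs.
  pigeonhole-multiple : (∀ {x x′ y} → R x y → R x′ y → x ≡ x′) → ∀ {as} → Unique as → All Images as → length as * K ≤ length ys
  pigeonhole-multiple injective as! ims with ps , ps! , |ps| , im , _ ← pairs as! ims =
    ≤-trans (≤-reflexive (sym |ps|)) (pigeonhole {R = R} injective ps! im)

-- Permutations and multiplicities

filter-split : {A : Set} {P : Pred A 0ℓ} (P? : Decidable P) (xs : List A) →
               xs ↭ filter P? xs ++ filter (¬? ∘ P?) xs
filter-split P? [] = ↭-refl
filter-split P? (x ∷ xs) with P? x
... | yes _ = prep x (filter-split P? xs)
... | no  _ = ↭-trans (prep x (filter-split P? xs)) (↭-sym (shift x (filter P? xs) _))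

length-filter-split : {A : Set} {P : Pred A 0ℓ} (P? : Decidable P) (xs : List A) →
                      length xs ≡ length (filter P? xs) + length (filter (¬? ∘ P?) xs)
length-filter-split P? xs = ≡-trans (↭-length (filter-split P? xs)) (length-++ (filter P? xs))

multiplicity : ℕ → List ℕ → ℕ
multiplicity x xs = length (filter (x ≟_) xs)

multiplicity-++ : ∀ x xs ys → multiplicity x (xs ++ ys) ≡ multiplicity x xs + multiplicity x ys
multiplicity-++ x xs ys = ≡-trans (cong length (filter-++ (x ≟_) xs ys)) (length-++ (filter (x ≟_) xs))

multiplicity-↭ : ∀ x {xs ys} → xs ↭ ys → multiplicity x xs ≡ multiplicity x ys
multiplicity-↭ x = ↭-length ∘ filter-↭ (x ≟_)

multiplicity-none : ∀ {x xs} → All (x ≢_) xs → multiplicity x xs ≡ 0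
multiplicity-none {x} = cong length ∘ filter-none (x ≟_)

multiplicity-replicate-++ : ∀ x s xs → multiplicity x (replicate s x ++ xs) ≡ s + multiplicity x xs
multiplicity-replicate-++ x zero    xs = refl
multiplicity-replicate-++ x (suc s) xs =
  ≡-trans (cong length (filter-accept (x ≟_) refl)) (cong suc (multiplicity-replicate-++ x s xs))

drop-replicate : ∀ s {x : ℕ} {xs ys} → replicate s x ++ xs ↭ replicate s x ++ ys → xs ↭ ys
drop-replicate zero    p = p
drop-replicate (suc s) p = drop-replicate s (drop-∷ p)

-- Counting `x` on both sides gives `s ≡ s′`; the copies of `x` then cancel.
strip-replicate : ∀ {x} s s′ {xs ys} → All (x ≢_) xs → All (x ≢_) ys →
                  replicate s x ++ xs ↭ replicate s′ x ++ ys → s ≡ s′ × xs ↭ ys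
strip-replicate {x} s s′ {xs} {ys} x∉xs x∉ys p = s≡s′ , drop-replicate s p′
  where
  open ≡-Reasoning
  s≡s′ : s ≡ s′
  s≡s′ = begin
    s                                       ≡⟨ +-identityʳ s ⟨
    s + 0                                   ≡⟨ cong (s +_) (multiplicity-none x∉xs) ⟨
    s + multiplicity x xs                   ≡⟨ multiplicity-replicate-++ x s xs ⟨
    multiplicity x (replicate s x ++ xs)    ≡⟨ multiplicity-↭ x p ⟩
    multiplicity x (replicate s′ x ++ ys)   ≡⟨ multiplicity-replicate-++ x s′ ys ⟩
    s′ + multiplicity x ys                  ≡⟨ cong (s′ +_) (multiplicity-none x∉ys) ⟩
    s′ + 0                                  ≡⟨ +-identityʳ s′ ⟩
    s′                                      ∎
  p′ : replicate s x ++ xs ↭ replicate s x ++ ys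
  p′ = subst (λ t → replicate s x ++ xs ↭ replicate t x ++ ys) (sym s≡s′) p

extract-replicate : ∀ {x} m xs → m ≤ multiplicity x xs → ∃ λ ys → xs ↭ replicate m x ++ ys
extract-replicate zero xs _ = xs , ↭-refl
extract-replicate {x} (suc m) (y ∷ xs) m≤ with x ≟ y
... | yes refl with ys , p ← extract-replicate m xs (s≤s⁻¹ (subst (suc m ≤_) (cong length (filter-accept (x ≟_) refl)) m≤)) =
      ys , prep x p
... | no x≢y with ys , p ← extract-replicate (suc m) xs (subst (suc m ≤_) (cong length (filter-reject (x ≟_) x≢y)) m≤) =
      y ∷ ys , ↭-trans (prep y p) (↭-sym (shift y (replicate (suc m) x) ys))

extract-∈ : ∀ {x : ℕ} {xs} → x ∈ xs → ∃ λ ys → xs ↭ x ∷ ys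
extract-∈ x∈xs with as , bs , refl ← ∈-∃++ x∈xs = as ++ bs , shift _ as bs

sum-replicate : ∀ s x → sum (replicate s x) ≡ s * x
sum-replicate zero    x = refl
sum-replicate (suc s) x = cong (x +_) (sum-replicate s x)

-- If the head occurs at most `m` times, discarding all its copies leaves at least `d * m` entries,
-- all different from it; induction on the number of distinct values sought.
distinct-or-repeated : ∀ d m .{{_ : NonZero m}} xs → d * m ≤ length xs →
  (∃ λ ps → Unique ps × length ps ≡ d × All (_∈ xs) ps) ⊎ (∃ λ p → m ≤ multiplicity p xs)
distinct-or-repeated zero m xs _ = inj₁ ([] , [] , refl , [])
distinct-or-repeated (suc d) (suc m) [] ()
distinct-or-repeated (suc d) m xs@(x ∷ _) d*m≤ with m ≤? multiplicity x xs
... | yes m≤ = inj₂ (x , m≤)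
... | no  m≰ = extend (distinct-or-repeated d m others d*m≤others)
  where
  open ≤-Reasoning
  others = filter (¬? ∘ (x ≟_)) xs
  ∈-others⁻ : ∀ {p} → p ∈ others → p ∈ xs × x ≢ p
  ∈-others⁻ = ∈-filter⁻ (¬? ∘ (x ≟_)) {xs = xs}
  d*m≤others : d * m ≤ length others
  d*m≤others = +-cancelˡ-≤ m _ _ (begin
    m + d * m                            ≤⟨ d*m≤ ⟩
    length xs                            ≡⟨ length-filter-split (x ≟_) xs ⟩
    multiplicity x xs + length others    ≤⟨ +-monoˡ-≤ _ (≰⇒≥ m≰) ⟩
    m + length others                    ∎)
  extend : (∃ λ ps → Unique ps × length ps ≡ d × All (_∈ others) ps) ⊎ (∃ λ p → m ≤ multiplicity p others) →
           (∃ λ ps → Unique ps × length ps ≡ suc d × All (_∈ xs) ps) ⊎ (∃ λ p → m ≤ multiplicity p xs)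
  extend (inj₁ (ps , ps! , |ps| , ps∈)) = inj₁
    ( x ∷ ps , All.map (proj₂ ∘ ∈-others⁻) ps∈ ∷ ps! , cong suc |ps|
    , here refl ∷ All.map (proj₁ ∘ ∈-others⁻) ps∈ )
  extend (inj₂ (p , m≤)) = inj₂ (p , (begin
    m                                                           ≤⟨ m≤ ⟩
    multiplicity p others                                       ≤⟨ m≤n+m _ _ ⟩
    multiplicity p (filter (x ≟_) xs) + multiplicity p others   ≡⟨ multiplicity-++ p (filter (x ≟_) xs) others ⟨
    multiplicity p (filter (x ≟_) xs ++ others)                 ≡⟨ multiplicity-↭ p (filter-split (x ≟_) xs) ⟨
    multiplicity p xs                                           ∎))

-- The enumeration of partitions

-- With the bound `m` put in front, `Linked` expresses both the order of the parts and the bound on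
-- the largest.
ptsF-sound : ∀ f n m {ν} → ν ∈ ptsF f n m → Linked _≥_ (m ∷ ν) × All (0 <_) ν × sum ν ≡ n
ptsF-sound f zero m (here refl) = [-] , [] , refl
ptsF-sound (suc f) (suc n) m ν∈
  with k , k∈ , ν∈k ← find (∈-concatMap⁻ (λ k → map (k ∷_) (ptsF f (suc n ∸ k) k)) {xs = applyUpTo suc (m ⊓ suc n)} ν∈)
  with i , i< , refl ← ∈-applyUpTo⁻ suc k∈
  with ν′ , ν′∈ , refl ← ∈-map⁻ (k ∷_) ν∈k
  with linked , positive , total ← ptsF-sound f (n ∸ i) (suc i) ν′∈ =
    m≤n⊓o⇒m≤n m (suc n) i< ∷ linked
  , s≤s z≤n ∷ positive
  , ≡-trans (cong (suc i +_) total) (m+[n∸m]≡n (m≤n⊓o⇒m≤o m (suc n) i<))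

ptsF-complete : ∀ f n m {ν} → n ≤ f → Linked _≥_ (m ∷ ν) → All (0 <_) ν → sum ν ≡ n → ν ∈ ptsF f n m
ptsF-complete f zero m {[]} _ _ _ _ = here refl
ptsF-complete f zero m {suc k ∷ ν} _ _ _ ()
ptsF-complete f zero m {zero ∷ ν} _ _ (() ∷ _) _
ptsF-complete (suc f) (suc n) m {suc i ∷ ν} (s≤s n≤f) (k≤m ∷ linked) (_ ∷ positive) total =
  ∈-concatMap⁺ (λ k → map (k ∷_) (ptsF f (suc n ∸ k) k))
    (Any.map (λ { refl → ∈-map⁺ (suc i ∷_) ν∈ }) (∈-applyUpTo⁺ suc (⊓-glb k≤m k≤n)))
  where
  k≤n : suc i ≤ suc n
  k≤n = subst (suc i ≤_) total (m≤m+n (suc i) (sum ν))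
  ν∈ : ν ∈ ptsF f (n ∸ i) (suc i)
  ν∈ = ptsF-complete f (n ∸ i) (suc i) (≤-trans (m∸n≤m n i) n≤f) linked positive
         (≡-trans (sym (m+n∸m≡n (suc i) (sum ν))) (cong (_∸ suc i) total))

ptsF-unique : ∀ f n m → Unique (ptsF f n m)
ptsF-unique f zero m = [] ∷ []
ptsF-unique zero (suc n) m = []
ptsF-unique (suc f) (suc n) m = Unique.concat⁺
  (All.map⁺ (All.universal (λ k → Unique.map⁺ (proj₂ ∘ ∷-injective) (ptsF-unique f (suc n ∸ k) k)) _))
  (AllPairs.map⁺ (AllPairs.applyUpTo⁺₁ suc (m ⊓ suc n) (λ i<j _ → disjoint i<j)))
  where
  disjoint : ∀ {i j ν} → i < j → ¬ (ν ∈ map (suc i ∷_) (ptsF f (n ∸ i) (suc i))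
                                    × ν ∈ map (suc j ∷_) (ptsF f (n ∸ j) (suc j)))
  disjoint {i} {j} i<j (ν∈i , ν∈j) with _ , _ , refl ← ∈-map⁻ (suc i ∷_) ν∈i | _ , _ , eq ← ∈-map⁻ (suc j ∷_) ν∈j =
    <⇒≢ i<j (suc-injective (proj₁ (∷-injective eq)))

module _ {T : Pred ℕ 0ℓ} (T? : Decidable T) (n : ℕ) where

  partitionsIn-unique : Unique (partitionsIn T? n)
  partitionsIn-unique = Unique.filter⁺ (all? T?) (ptsF-unique n n n)

  partitionsIn-sound : ∀ {ν} → ν ∈ partitionsIn T? n → Linked _≥_ ν × All T ν × sum ν ≡ n
  partitionsIn-sound ν∈ with ν∈′ , inT ← ∈-filter⁻ (all? T?) {xs = partitions n} ν∈
    with linked , _ , total ← ptsF-sound n n n ν∈′ = Linked.tail linked , inT , total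

  -- Lets later constructions give partitions as unordered lists; sorting produces the enumerated
  -- representative.
  partitionsIn-complete : ∀ {μ} → All (0 <_) μ → All T μ → sum μ ≡ n → ∃ λ ν → ν ∈ partitionsIn T? n × ν ↭ μ
  partitionsIn-complete {μ} positive inT total =
      sort μ
    , ∈-filter⁺ (all? T?) (ptsF-complete n n n ≤-refl (bounded (sort-↗ μ) sumSort) (resp positive) sumSort) (resp inT)
    , sort-↭ μ
    where
    resp : ∀ {P : Pred ℕ 0ℓ} → All P μ → All P (sort μ)
    resp = All-resp-↭ (↭-sym (sort-↭ μ))
    sumSort : sum (sort μ) ≡ n
    sumSort = ≡-trans (sum-↭ (sort-↭ μ)) total
    bounded : ∀ {ν} → Linked _≥_ ν → sum ν ≡ n → Linked _≥_ (n ∷ ν)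
    bounded {[]}    _      _  = [-]
    bounded {x ∷ ν} linked eq = subst (x ≤_) eq (m≤m+n x (sum ν)) ∷ linked

-- Injectivity of the multinomial coefficient on partitions into ones and primes

prime>1 : ∀ {p} → Prime p → 1 < p
prime>1 pr = nonTrivial⇒n>1 _ {{prime⇒nonTrivial pr}}

oneOrPrime>0 : ∀ {k} → OneOrPrime k → 0 < k
oneOrPrime>0 (inj₁ refl) = s≤s z≤n
oneOrPrime>0 (inj₂ pr)   = <⇒≤ (prime>1 pr)

prime∣!⇒≤ : ∀ {p} → Prime p → ∀ k → p ∣ k ! → p ≤ k
prime∣!⇒≤ pr zero    p∣1 = contradiction (∣1⇒≡1 p∣1) (>⇒≢ (prime>1 pr))
prime∣!⇒≤ pr (suc k) p∣  with euclidsLemma (suc k) (k !) pr p∣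
... | inj₁ p∣k  = ∣⇒≤ p∣k
... | inj₂ p∣k! = m≤n⇒m≤1+n (prime∣!⇒≤ pr k p∣k!)

prime∣prodFact⇒≤ : ∀ {p m ν} → Prime p → All (m ≥_) ν → p ∣ prodFact ν → p ≤ m
prime∣prodFact⇒≤ pr [] p∣1 = contradiction (∣1⇒≡1 p∣1) (>⇒≢ (prime>1 pr))
prime∣prodFact⇒≤ {ν = k ∷ ν} pr (k≤m ∷ ν≤m) p∣ with euclidsLemma (k !) (prodFact ν) pr p∣
... | inj₁ p∣k! = ≤-trans (prime∣!⇒≤ pr k p∣k!) k≤m
... | inj₂ p∣ν  = prime∣prodFact⇒≤ pr ν≤m p∣ν

n∣n! : ∀ {n} → 0 < n → n ∣ n !
n∣n! {suc n} _ = m∣m*n (n !)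

-- A prime `x` divides `x !`, hence by Euclid's lemma the factorial of some part of `y ∷ ν`, and `y`
-- is the largest of these.
head-≤ : ∀ {x y μ ν} → Linked _≥_ (y ∷ ν) → OneOrPrime x → OneOrPrime y →
         prodFact (x ∷ μ) ≡ prodFact (y ∷ ν) → x ≤ y
head-≤ _ (inj₁ refl) oy _ = oneOrPrime>0 oy
head-≤ {x} {y} {μ} linked ox@(inj₂ pr) _ eq =
  prime∣prodFact⇒≤ pr (Linked⇒All (λ i≥j j≥k → ≤-trans j≥k i≥j) ≤-refl linked)
    (subst (x ∣_) eq (∣m⇒∣m*n (prodFact μ) (n∣n! (oneOrPrime>0 ox))))

-- The heads agree by `head-≤` in both directions and cancel from sums and products. When one list
-- runs out, equality of the sums empties the other; the products cannot do this, as `1 !` is 1.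
prodFact-injective : ∀ {μ ν} → Linked _≥_ μ → Linked _≥_ ν → All OneOrPrime μ → All OneOrPrime ν →
                     sum μ ≡ sum ν → prodFact μ ≡ prodFact ν → μ ≡ ν
prodFact-injective {[]} {[]} _ _ _ _ _ _ = refl
prodFact-injective {[]} {y ∷ ν} _ _ _ (oy ∷ _) eq _ =
  contradiction eq (<⇒≢ (<-≤-trans (oneOrPrime>0 oy) (m≤m+n y (sum ν))))
prodFact-injective {x ∷ μ} {[]} _ _ (ox ∷ _) _ eq _ =
  contradiction eq (>⇒≢ (<-≤-trans (oneOrPrime>0 ox) (m≤m+n x (sum μ))))
prodFact-injective {x ∷ μ} {y ∷ ν} lμ lν (ox ∷ oμ) (oy ∷ oν) sums prods
  with refl ← ≤-antisym (head-≤ {μ = μ} lν ox oy prods) (head-≤ {μ = ν} lμ oy ox (sym prods)) =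
    cong (x ∷_) (prodFact-injective (Linked.tail lμ) (Linked.tail lν) oμ oν
      (+-cancelˡ-≡ x _ _ sums) (*-cancelˡ-≡ _ _ (x !) {{x !≢0}} prods))

-- Integrality of the multinomial coefficient, by induction from that of the binomial one; it makes
-- the division in `multinomial` exact.
prodFact∣sum! : ∀ ν → prodFact ν ∣ sum ν !
prodFact∣sum! [] = ∣-refl
prodFact∣sum! (k ∷ ν) = ∣-trans (*-monoʳ-∣ (k !) (prodFact∣sum! ν))
  (subst (λ m → k ! * m ! ∣ (k + sum ν) !) (m+n∸m≡n k (sum ν)) (k![n∸k]!∣n! (m≤m+n k (sum ν))))

prodFact-↭ : ∀ {μ ν} → μ ↭ ν → prodFact μ ≡ prodFact ν
prodFact-↭ refl = refl
prodFact-↭ (prep x p) = cong (x ! *_) (prodFact-↭ p)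
prodFact-↭ (trans p q) = ≡-trans (prodFact-↭ p) (prodFact-↭ q)
prodFact-↭ {_ ∷ _ ∷ μ} {_ ∷ _ ∷ ν} (swap x y p) = begin
  x ! * (y ! * prodFact μ)  ≡⟨ cong (λ m → x ! * (y ! * m)) (prodFact-↭ p) ⟩
  x ! * (y ! * prodFact ν)  ≡⟨ *-assoc (x !) (y !) _ ⟨
  x ! * y ! * prodFact ν    ≡⟨ cong (_* prodFact ν) (*-comm (x !) (y !)) ⟩
  y ! * x ! * prodFact ν    ≡⟨ *-assoc (y !) (x !) _ ⟩
  y ! * (x ! * prodFact ν)  ∎
  where open ≡-Reasoning

multinomial*prodFact : ∀ ν → multinomial (sum ν) ν * prodFact ν ≡ sum ν !
multinomial*prodFact ν = m/n*n≡m {{prodFact≢0 ν}} (prodFact∣sum! ν)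

multinomial-injective : ∀ {n} μ ν → sum μ ≡ n → sum ν ≡ n → multinomial n μ ≡ multinomial n ν →
                        prodFact μ ≡ prodFact ν
multinomial-injective {n} μ ν refl sums eq =
  *-cancelˡ-≡ _ _ (multinomial n μ) {{m≢0}} (≡-trans (multinomial*prodFact μ) (sym eq′))
  where
  eq′ : multinomial n μ * prodFact ν ≡ n !
  eq′ = ≡-trans (cong (_* prodFact ν) eq)
          (subst (λ m → multinomial m ν * prodFact ν ≡ m !) sums (multinomial*prodFact ν))
  m≢0 : NonZero (multinomial n μ)
  m≢0 = m*n≢0⇒m≢0 (multinomial n μ) {{subst NonZero (sym (multinomial*prodFact μ)) (n !≢0)}}

-- `L` is left open so that the bound serves both `M-in oneOrPrime?` and `M`. The relation carries
-- membership because injectivity is available only for parts that are one or prime.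
count≤distinctMultinomials : ∀ n {L} → (∀ {ν} → ν ∈ partitionsIn oneOrPrime? n → ν ∈ L) →
  length (partitionsIn oneOrPrime? n) ≤ length (deduplicate _≟_ (map (multinomial n) L))
count≤distinctMultinomials n ⊆L =
  pigeonhole {R = λ ν v → ν ∈ partitionsIn oneOrPrime? n × v ≡ multinomial n ν} injective
    (partitionsIn-unique oneOrPrime? n)
    (All.tabulate λ {ν} ν∈ → multinomial n ν , ∈-deduplicate⁺ _≟_ (∈-map⁺ (multinomial n) (⊆L ν∈)) , ν∈ , refl)
  where
  injective : ∀ {μ ν v} → μ ∈ partitionsIn oneOrPrime? n × v ≡ multinomial n μ →
              ν ∈ partitionsIn oneOrPrime? n × v ≡ multinomial n ν → μ ≡ ν
  injective {μ} {ν} (μ∈ , refl) (ν∈ , eq)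
    with lμ , oμ , sμ ← partitionsIn-sound oneOrPrime? n μ∈ | lν , oν , sν ← partitionsIn-sound oneOrPrime? n ν∈ =
      prodFact-injective lμ lν oμ oν (≡-trans sμ (sym sν)) (multinomial-injective μ ν sμ sν eq)

-- Partitions with many parts

-- The factorial product is invariant under permutation, so `prodFact-injective` yields uniqueness
-- of the sorted arrangement.
primePartition-↭⇒≡ : ∀ n {μ ν} → μ ∈ partitionsIn prime? n → ν ∈ partitionsIn prime? n → μ ↭ ν → μ ≡ ν
primePartition-↭⇒≡ n μ∈ ν∈ p
  with lμ , oμ , sμ ← partitionsIn-sound prime? n μ∈ | lν , oν , sν ← partitionsIn-sound prime? n ν∈ =
    prodFact-injective lμ lν (All.map inj₂ oμ) (All.map inj₂ oν) (≡-trans sμ (sym sν)) (prodFact-↭ p)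

realize : ∀ n μ → All OneOrPrime μ → sum μ ≡ n → ∃ λ ν → ν ∈ partitionsIn oneOrPrime? n × ν ↭ μ
realize n μ oμ = partitionsIn-complete oneOrPrime? n (All.map oneOrPrime>0 oμ) oμ

prime≢1 : ∀ {p} → Prime p → 1 ≢ p
prime≢1 pr = <⇒≢ (prime>1 pr)

prime≢2*n : ∀ {p n} → Prime p → 1 < n → p ≢ 2 * n
prime≢2*n {p} {n} pr 1<n p≡2n with prime⇒irreducible pr (divides n (≡-trans p≡2n (*-comm 2 n)))
... | inj₁ ()
... | inj₂ refl = <⇒≢ (*-monoʳ-< 2 1<n) p≡2n

1<2^i*p : ∀ i {p} → Prime p → 1 < 2 ^ i * p
1<2^i*p i {p} pr = <-≤-trans (prime>1 pr) (m≤n*m p (2 ^ i) {{m^n≢0 2 i}})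

-- Factors of 2 are cancelled in pairs. If one side runs out first, a prime equals `2 * n` with
-- `1 < n`, which is impossible even for the prime 2.
2^i*p-injective : ∀ i j {p q} → Prime p → Prime q → 2 ^ i * p ≡ 2 ^ j * q → (p , i) ≡ (q , j)
2^i*p-injective zero zero {p} {q} pp pq eq =
  cong (_, 0) (≡-trans (sym (*-identityˡ p)) (≡-trans eq (*-identityˡ q)))
2^i*p-injective zero (suc j) {p} {q} pp pq eq =
  contradiction (≡-trans (sym (*-identityˡ p)) (≡-trans eq (*-assoc 2 (2 ^ j) q))) (prime≢2*n pp (1<2^i*p j pq))
2^i*p-injective (suc i) zero {p} {q} pp pq eq =
  contradiction (≡-trans (sym (*-identityˡ q)) (≡-trans (sym eq) (*-assoc 2 (2 ^ i) p))) (prime≢2*n pq (1<2^i*p i pp))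
2^i*p-injective (suc i) (suc j) {p} {q} pp pq eq =
  cong (λ (r , k) → r , suc k) (2^i*p-injective i j pp pq
    (*-cancelˡ-≡ _ _ 2 (≡-trans (sym (*-assoc 2 (2 ^ i) p)) (≡-trans eq (*-assoc 2 (2 ^ j) q)))))

1∉rest : ∀ n {κ} xs {μ} → κ ∈ partitionsIn prime? n → κ ↭ xs ++ μ → All (1 ≢_) μ
1∉rest n xs κ∈ κ↭ = All.map prime≢1 (All.++⁻ʳ xs (All-resp-↭ κ↭ (proj₁ (proj₂ (partitionsIn-sound prime? n κ∈)))))

-- The number of copies replaced is a power of 2 so that the number of ones determines both `p` and
-- `i`.
CopiesToOnes : ℕ → List ℕ × (ℕ × ℕ) → List ℕ → Set
CopiesToOnes n (κ , (p , i)) ν = κ ∈ partitionsIn prime? n × Prime p ×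
  ∃ λ μ → κ ↭ replicate (2 ^ i) p ++ μ × ν ↭ replicate (2 ^ i * p) 1 ++ μ

-- `κ` contains no ones, so the ones of `ν` are exactly the new ones. Their number gives `p` and
-- `i`, and the remaining parts then give back `κ`.
copiesToOnes-injective : ∀ n {x x′ ν} → CopiesToOnes n x ν → CopiesToOnes n x′ ν → x ≡ x′
copiesToOnes-injective n {x = κ , (p , i)} {κ′ , (p′ , i′)} (κ∈ , pp , μ , κ↭ , ν↭) (κ′∈ , pp′ , μ′ , κ′↭ , ν′↭)
  with s≡ , μ↭μ′ ← strip-replicate (2 ^ i * p) (2 ^ i′ * p′)
                        (1∉rest n (replicate (2 ^ i) p) κ∈ κ↭) (1∉rest n (replicate (2 ^ i′) p′) κ′∈ κ′↭) (↭-trans (↭-sym ν↭) ν′↭)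
  with refl ← 2^i*p-injective i i′ pp pp′ s≡ =
  cong (_, (p , i)) (primePartition-↭⇒≡ n κ∈ κ′∈ (↭-trans κ↭ (↭-trans (++⁺ˡ (replicate (2 ^ i) p) μ↭μ′) (↭-sym κ′↭))))

copiesToOnes-exists : ∀ n {κ μ} p i → κ ∈ partitionsIn prime? n → κ ↭ replicate (2 ^ i) p ++ μ →
  ∃ λ ν → ν ∈ partitionsIn oneOrPrime? n × CopiesToOnes n (κ , (p , i)) ν
copiesToOnes-exists n {κ} {μ} p i κ∈ κ↭ =
    let ν , ν∈ , ν↭ = realize n (replicate (2 ^ i * p) 1 ++ μ) (All.++⁺ (All.replicate⁺ _ (inj₁ refl)) (All.map inj₂ oμ)) total
    in ν , ν∈ , κ∈ , pp (2 ^ i) {{m^n≢0 2 i}} oκ′ , μ , κ↭ , ν↭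
  where
  open ≡-Reasoning
  oκ′ : All Prime (replicate (2 ^ i) p ++ μ)
  oκ′ = All-resp-↭ κ↭ (proj₁ (proj₂ (partitionsIn-sound prime? n κ∈)))
  oμ : All Prime μ
  oμ = All.++⁻ʳ (replicate (2 ^ i) p) oκ′
  -- At least one copy of `p` is present, so `p` inherits primality from `κ`.
  pp : ∀ m .{{_ : NonZero m}} → All Prime (replicate m p ++ μ) → Prime p
  pp (suc m) (pr ∷ _) = pr
  total : sum (replicate (2 ^ i * p) 1 ++ μ) ≡ n
  total = begin
    sum (replicate (2 ^ i * p) 1 ++ μ)       ≡⟨ sum-++ (replicate (2 ^ i * p) 1) μ ⟩
    sum (replicate (2 ^ i * p) 1) + sum μ    ≡⟨ cong (_+ sum μ) (≡-trans (sum-replicate (2 ^ i * p) 1) (*-identityʳ _)) ⟩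
    2 ^ i * p + sum μ                        ≡⟨ cong (_+ sum μ) (sum-replicate (2 ^ i) p) ⟨
    sum (replicate (2 ^ i) p) + sum μ        ≡⟨ sum-++ (replicate (2 ^ i) p) μ ⟨
    sum (replicate (2 ^ i) p ++ μ)           ≡⟨ sum-↭ κ↭ ⟨
    sum κ                                    ≡⟨ proj₂ (proj₂ (partitionsIn-sound prime? n κ∈)) ⟩
    n                                        ∎

long-images : ∀ n {κ} K → κ ∈ partitionsIn prime? n → K * 2 ^ K ≤ length κ →
              Images (CopiesToOnes n) K (partitionsIn oneOrPrime? n) κ
long-images n {κ} K κ∈ long with distinct-or-repeated K (2 ^ K) {{m^n≢0 2 K}} κ long
-- Distinct parts: the prime varies, and a single copy, `2 ^ 0`, is replaced.
... | inj₁ (ps , ps! , |ps| , ps∈) =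
      map (_, 0) ps , Unique.map⁺ (cong proj₁) ps! , ≡-trans (length-map (_, 0) ps) |ps| ,
      All.map⁺ (All.map (λ {p} p∈ → copiesToOnes-exists n p 0 κ∈ (proj₂ (extract-∈ p∈))) ps∈)
-- Repeated part: the prime is fixed and the exponent runs over `i < K`.
... | inj₂ (p , 2^K≤) =
      map (p ,_) (upTo K) , Unique.map⁺ (cong proj₂) (Unique.upTo⁺ K) , ≡-trans (length-map (p ,_) (upTo K)) (length-upTo K) ,
      All.map⁺ (All.tabulate λ {i} i∈ → copiesToOnes-exists n p i κ∈ (proj₂ (extract-replicate (2 ^ i) κ
        (≤-trans (^-monoʳ-≤ 2 (<⇒≤ (∈-upTo⁻ i∈))) 2^K≤))))

-- Partitions with few parts

-- Half of the uniqueness of the quotient on division by `T`; exchanging the two sides gives the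
-- other half.
quotient-≤ : ∀ T i i′ {c c′} → c′ < T → T * i + c ≡ T * i′ + c′ → i ≤ i′
quotient-≤ T i i′ {c} {c′} c′<T eq = s≤s⁻¹ (*-cancelˡ-< T i (suc i′) (begin-strict
  T * i         ≤⟨ m≤m+n (T * i) c ⟩
  T * i + c     ≡⟨ eq ⟩
  T * i′ + c′   <⟨ +-monoʳ-< (T * i′) c′<T ⟩
  T * i′ + T    ≡⟨ +-comm (T * i′) T ⟩
  T + T * i′    ≡⟨ *-suc T i′ ⟨
  T * suc i′    ∎))
  where open ≤-Reasoning

-- Twos are added in multiples of `T`, and `μ` has fewer than `T` of its own, so `i` is the quotient
-- of their total number by `T`. The remainder `b` of `p` becomes ones.
LargestToTwos : ℕ → ℕ → List ℕ × ℕ → List ℕ → Set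
LargestToTwos T n (κ , i) ν = κ ∈ partitionsIn prime? n ×
  ∃ λ p → ∃ λ μ → ∃ λ b → κ ≡ p ∷ μ × length μ < T × p ≡ T * i * 2 + b ×
    ν ↭ replicate (T * i) 2 ++ replicate b 1 ++ μ

largestToTwos-injective : ∀ T n {x x′ ν} → LargestToTwos T n x ν → LargestToTwos T n x′ ν → x ≡ x′
largestToTwos-injective T n {x = κ , i} {κ′ , i′} {ν}
  (κ∈ , p , μ , b , refl , |μ|<T , refl , ν↭) (κ′∈ , p′ , μ′ , b′ , refl , |μ′|<T , refl , ν′↭) =
    cong₂ _,_ (primePartition-↭⇒≡ n κ∈ κ′∈ κ↭κ′) i≡i′
  where
  <T : ∀ b μ → length μ < T → multiplicity 2 (replicate b 1 ++ μ) < T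
  <T zero    μ lt = ≤-<-trans (length-filter (2 ≟_) μ) lt
  <T (suc b) μ lt = <T b μ lt
  ν↭ν′ : replicate (T * i) 2 ++ replicate b 1 ++ μ ↭ replicate (T * i′) 2 ++ replicate b′ 1 ++ μ′
  ν↭ν′ = ↭-trans (↭-sym ν↭) ν′↭
  twos : T * i + multiplicity 2 (replicate b 1 ++ μ) ≡ T * i′ + multiplicity 2 (replicate b′ 1 ++ μ′)
  twos = begin
    T * i + multiplicity 2 (replicate b 1 ++ μ)                     ≡⟨ multiplicity-replicate-++ 2 (T * i) _ ⟨
    multiplicity 2 (replicate (T * i) 2 ++ replicate b 1 ++ μ)      ≡⟨ multiplicity-↭ 2 ν↭ν′ ⟩
    multiplicity 2 (replicate (T * i′) 2 ++ replicate b′ 1 ++ μ′)   ≡⟨ multiplicity-replicate-++ 2 (T * i′) _ ⟩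
    T * i′ + multiplicity 2 (replicate b′ 1 ++ μ′)                  ∎
    where open ≡-Reasoning
  i≡i′ : i ≡ i′
  i≡i′ = ≤-antisym (quotient-≤ T i i′ (<T b′ μ′ |μ′|<T) twos) (quotient-≤ T i′ i (<T b μ |μ|<T) (sym twos))
  ones : replicate b 1 ++ μ ↭ replicate b′ 1 ++ μ′
  ones = drop-replicate (T * i) (subst (λ j → _ ↭ replicate (T * j) 2 ++ replicate b′ 1 ++ μ′) (sym i≡i′) ν↭ν′)
  κ↭κ′ : κ ↭ κ′
  -- The ones left after cancelling twos determine `b`; since `p` is `T * i * 2 + b`, the largest
  -- parts then coincide.
  κ↭κ′ with refl ← i≡i′
       with refl , μ↭μ′ ← strip-replicate b b′ (1∉rest n [ p ] κ∈ ↭-refl) (1∉rest n [ p′ ] κ′∈ ↭-refl) ones =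
    prep p μ↭μ′

sum≤length* : ∀ {m ν} → All (m ≥_) ν → sum ν ≤ length ν * m
sum≤length* []            = z≤n
sum≤length* (k≤m ∷ ν≤m) = +-mono-≤ k≤m (sum≤length* ν≤m)

short-images : ∀ n {κ} K T → 0 < T * (T * K * 2) → T * (T * K * 2) ≤ n → κ ∈ partitionsIn prime? n → length κ < T →
               Images (LargestToTwos T n) K (partitionsIn oneOrPrime? n) κ
-- The threshold is positive, so `n` is positive and the empty partition is excluded.
short-images n {[]} K T 0<N N≤n κ∈ _ =
  contradiction (proj₂ (proj₂ (partitionsIn-sound prime? n κ∈))) (<⇒≢ (<-≤-trans 0<N N≤n))
short-images n {p ∷ μ} K T 0<N N≤n κ∈ short with linked , _ ∷ oμ , total ← partitionsIn-sound prime? n κ∈ =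
  upTo K , Unique.upTo⁺ K , length-upTo K , All.tabulate λ {i} i∈ → image i (∈-upTo⁻ i∈) oμ total
  where
  -- Fewer than `T` parts, none above `p`, have sum at least `T * (T * K * 2)`.
  2TK≤p : Linked _≥_ (p ∷ μ) → sum (p ∷ μ) ≡ n → T * K * 2 ≤ p
  2TK≤p linked total = *-cancelˡ-≤ T {{>-nonZero (≤-<-trans z≤n short)}} (begin
    T * (T * K * 2)          ≤⟨ N≤n ⟩
    n                        ≡⟨ total ⟨
    sum (p ∷ μ)              ≤⟨ sum≤length* (Linked⇒All (λ i≥j j≥k → ≤-trans j≥k i≥j) ≤-refl linked) ⟩
    length (p ∷ μ) * p       ≤⟨ *-monoˡ-≤ p (<⇒≤ short) ⟩
    T * p                    ∎)
    where open ≤-Reasoning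
  image : ∀ i → i < K → All Prime μ → sum (p ∷ μ) ≡ n →
          Image (LargestToTwos T n) K (partitionsIn oneOrPrime? n) (p ∷ μ , i)
  image i i<K oμ total =
    let ν , ν∈ , ν↭ = realize n (replicate (T * i) 2 ++ replicate b 1 ++ μ)
                        (All.++⁺ (All.replicate⁺ (T * i) (inj₂ prime[2])) (All.++⁺ (All.replicate⁺ b (inj₁ refl)) (All.map inj₂ oμ)))
                        total′
    in ν , ν∈ , κ∈ , p , μ , b , refl , <-trans (n<1+n _) short , sym split , ν↭
    where
    -- No truncation occurs: `i < K` and `2TK≤p` give `T * i * 2 ≤ p`.
    b = p ∸ T * i * 2
    split : T * i * 2 + b ≡ p
    split = m+[n∸m]≡n (≤-trans (*-monoˡ-≤ 2 (*-monoʳ-≤ T (<⇒≤ i<K)))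
              (2TK≤p (proj₁ (partitionsIn-sound prime? n κ∈)) total))
    open ≡-Reasoning
    total′ : sum (replicate (T * i) 2 ++ replicate b 1 ++ μ) ≡ n
    total′ = begin
      sum (replicate (T * i) 2 ++ replicate b 1 ++ μ)       ≡⟨ sum-++ (replicate (T * i) 2) _ ⟩
      sum (replicate (T * i) 2) + sum (replicate b 1 ++ μ)  ≡⟨ cong₂ _+_ (sum-replicate (T * i) 2) (sum-++ (replicate b 1) μ) ⟩
      T * i * 2 + (sum (replicate b 1) + sum μ)             ≡⟨ cong (λ m → T * i * 2 + (m + sum μ)) (≡-trans (sum-replicate b 1) (*-identityʳ b)) ⟩
      T * i * 2 + (b + sum μ)                               ≡⟨ +-assoc (T * i * 2) b (sum μ) ⟨
      T * i * 2 + b + sum μ                                 ≡⟨ cong (_+ sum μ) split ⟩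
      p + sum μ                                             ≡⟨ total ⟩
      n                                                     ∎

-- Combination of the two cases and passage to the limit

primePartitions-rare : ∀ K .{{_ : NonZero K}} → ∃ λ N → ∀ n → N ≤ n →
                       pPrime n * K ≤ length (partitionsIn oneOrPrime? n) + length (partitionsIn oneOrPrime? n)
primePartitions-rare K = T * (T * K * 2) , λ n N≤n →
  let long? = λ κ → T ≤? length κ
      P     = partitionsIn prime? n
      Q     = partitionsIn oneOrPrime? n
      P!    = partitionsIn-unique prime? n
      open ≤-Reasoning
  in begin
    length P * K
      ≡⟨ cong (_* K) (length-filter-split long? P) ⟩
    (length (filter long? P) + length (filter (¬? ∘ long?) P)) * K
      ≡⟨ *-distribʳ-+ K (length (filter long? P)) _ ⟩
    length (filter long? P) * K + length (filter (¬? ∘ long?) P) * K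
      -- Images of long and of short partitions may coincide, so `Q` is counted once for each class.
      ≤⟨ +-mono-≤
           (pigeonhole-multiple (CopiesToOnes n) K Q (copiesToOnes-injective n) (Unique.filter⁺ long? P!)
             (All.tabulate λ κ∈ → let κ∈P , long = ∈-filter⁻ long? {xs = P} κ∈ in long-images n K κ∈P long))
           (pigeonhole-multiple (LargestToTwos T n) K Q (largestToTwos-injective T n) (Unique.filter⁺ (¬? ∘ long?) P!)
             (All.tabulate λ κ∈ → let κ∈P , short = ∈-filter⁻ (¬? ∘ long?) {xs = P} κ∈ in
               short-images n K T 0<N N≤n κ∈P (≰⇒> short))) ⟩
    length Q + length Q
      ∎
  where
  T = K * 2 ^ K
  0<N : 0 < T * (T * K * 2)
  0<N = >-nonZero⁻¹ (T * (T * K * 2)) {{m*n≢0 T (T * K * 2) {{T≢0}} {{m*n≢0 (T * K) 2 {{m*n≢0 T K {{T≢0}}}}}}}}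
    where
    T≢0 : NonZero T
    T≢0 = m*n≢0 K (2 ^ K) {{it}} {{m^n≢0 2 K}}

0<partitionsInOneOrPrime : ∀ n → 0 < length (partitionsIn oneOrPrime? n)
0<partitionsInOneOrPrime n with ν , ν∈ , _ ← realize n (replicate n 1) (All.replicate⁺ n (inj₁ refl))
                                              (≡-trans (sum-replicate n 1) (*-identityʳ n)) = nonempty ν∈
  where
  nonempty : ∀ {ν : List ℕ} {xs} → ν ∈ xs → 0 < length xs
  nonempty (here _)  = s≤s z≤n
  nonempty (there _) = s≤s z≤n

pPrime/partitionsInOneOrPrime→0 : RatioTendsToZero pPrime (λ n → length (partitionsIn oneOrPrime? n))
-- The factor 2 absorbs the double count of the target. Taking `suc (suc k)` in place of `suc k`
-- leaves a spare `p`, which makes the inequality strict if `p` is positive; if `p` is 0, the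
-- partition into ones does.
pPrime/partitionsInOneOrPrime→0 k with N , rare ← primePartitions-rare (2 * suc (suc k)) = N , λ n N≤n →
  let p = pPrime n
      q = length (partitionsIn oneOrPrime? n)
      open ≤-Reasoning
      bound : suc (suc k) * p ≤ q
      bound = *-cancelˡ-≤ 2 (begin
        2 * (suc (suc k) * p)   ≡⟨ *-assoc 2 (suc (suc k)) p ⟨
        2 * suc (suc k) * p     ≡⟨ *-comm (2 * suc (suc k)) p ⟩
        p * (2 * suc (suc k))   ≤⟨ rare n N≤n ⟩
        q + q                   ≡⟨ cong (q +_) (+-identityʳ q) ⟨
        2 * q                   ∎)
  in strengthen k p q (0<partitionsInOneOrPrime n) bound
  where
  strengthen : ∀ k p q → 0 < q → suc (suc k) * p ≤ q → suc k * p < q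
  strengthen k zero    q 0<q _     = subst (_< q) (sym (*-zeroʳ (suc k))) 0<q
  strengthen k (suc p) q _   bound = <-≤-trans (m<n+m (suc k * suc p) (s≤s z≤n)) bound

theorem12 : RatioTendsToZero pPrime (M-in oneOrPrime?) × RatioTendsToZero pPrime M
theorem12 = below (λ n → count≤distinctMultinomials n id)
          -- Partitions into ones and primes are among all partitions, so the same count also bounds
          -- `M` from below.
          , below (λ n → count≤distinctMultinomials n (proj₁ ∘ ∈-filter⁻ (all? oneOrPrime?) {xs = partitions n}))
  where
  below : ∀ {g} → (∀ n → length (partitionsIn oneOrPrime? n) ≤ g n) → RatioTendsToZero pPrime g
  below q≤g k with N , lt ← pPrime/partitionsInOneOrPrime→0 k = N , λ n N≤n → <-≤-trans (lt n N≤n) (q≤g n)
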